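{- Let $c$ be an indeterminate (or any scalar in a field of characteristic $0$) and let $(a_n)_{n\ge0}$ be defined by $$f(x)=\sum_{n\ge0}a_n\,\frac{x^n}{n!}=e^{cx+x^2/2},\qquad\text{i.e.}\qquad a_n=\sum_{j\ge 0}\binom{n}{2j}(2j-1)!!\,c^{\,n-2j}.$$ Then for all $n\ge 1$, $$\ddot H_n(f)=\det(a_{2i+j})_{0\le i,j\le n-1}=(2c)^{\binom n2}\prod_{k=1}^{n-1}k!.$$
   Context: For a power series $f(x)=\sum_{n\ge0}a_nx^n/n!$, the dilated Hankel determinant is $\ddot H_n(f)=\det(a_{2i+j})_{0\le i,j\le n-1}$. Conventions: $m!!=m(m-2)(m-4)\cdots$ down to $1$ or $2$, with $0!!=(-1)!!=1$; empty products equal $1$. -}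

module Defs where

open import Algebra.Bundles using (CommutativeRing; Semiring)
open import Algebra.Apartness.Bundles using (HeytingField; HeytingCommutativeRing)
import Algebra.Definitions.RawSemiring as RawSemiringDefs
open import Data.Fin.Base using (Fin; zero; suc; toℕ)
open import Data.Nat.Base as ℕ using (ℕ; zero; suc; _∸_; _!; NonZero)
open import Data.Nat.Properties using (_!≢0)
open import Data.Product.Base using (proj₁)
open import Data.Vec.Functional using (Vector; removeAt)

infix 8 _!!

_!! : ℕ → ℕ
zero        !! = 1
suc zero    !! = 1
suc (suc n) !! = suc (suc n) ℕ.* n !!

module Determinant {c ℓ} (R : CommutativeRing c ℓ) where

  open CommutativeRing R hiding (zero)
  open RawSemiringDefs (Semiring.rawSemiring semiring) using (sum; _^_)

  -- Laplace expansion along the first row; rows are the outer index.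
  det : ∀ {n} → Vector (Vector Carrier n) n → Carrier
  det {zero}  A = 1#
  det {suc n} A = sum λ (j : Fin (suc n)) →
    (- 1#) ^ toℕ j * (A zero j * det (λ i → removeAt (A (suc i)) j))

-- `n · x` is the n-fold sum of x, written `n × x` in the library.
module FieldOps {c ℓ₁ ℓ₂} (K : HeytingField c ℓ₁ ℓ₂) where

  open HeytingField K public
    using (Carrier; _≈_; _#_; _+_; _*_; -_; 0#; 1#)

  ring : CommutativeRing c ℓ₁
  ring = HeytingCommutativeRing.commutativeRing (HeytingField.heytingCommutativeRing K)

  open RawSemiringDefs (Semiring.rawSemiring (CommutativeRing.semiring ring)) public
    using (sum; product; _^_) renaming (_×_ to infixr 8 _·_)

  open Determinant ring public using (det)

-- In a Heyting field "nonzero" means apart from zero; for a field with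
-- decidable equality this is the usual condition n · 1 ≉ 0.
CharacteristicZero : ∀ {c ℓ₁ ℓ₂} → HeytingField c ℓ₁ ℓ₂ → Set ℓ₂
CharacteristicZero K = ∀ n .{{_ : NonZero n}} → n · 1# # 0#
  where open FieldOps K

module Series {c ℓ₁ ℓ₂} (K : HeytingField c ℓ₁ ℓ₂) (char0 : CharacteristicZero K) where

  open FieldOps K public

  -- 1/n.  (The library provides the inverse of n · 1# - 0#.)
  recip : ∀ n .{{_ : NonZero n}} → Carrier
  recip n = proj₁ (HeytingField.#⇒invertible K (char0 n))

  -- A formal power series is its sequence of ordinary coefficients [xⁿ]f.
  PowerSeries : Set c
  PowerSeries = ℕ → Carrier

  infixl 7 _⊛_
  infixr 8 _^⊛_

  _⊛_ : PowerSeries → PowerSeries → PowerSeries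
  (f ⊛ g) n = sum λ (i : Fin (suc n)) → f (toℕ i) * g (n ∸ toℕ i)

  one : PowerSeries
  one zero    = 1#
  one (suc _) = 0#

  _^⊛_ : PowerSeries → ℕ → PowerSeries
  f ^⊛ zero  = one
  f ^⊛ suc k = f ⊛ f ^⊛ k

  -- exp g = Σₖ gᵏ / k!, for g with zero constant term.  Then gᵏ has no terms
  -- of degree below k, so only the summands k ≤ n contribute to [xⁿ].
  exp : PowerSeries → PowerSeries
  exp g n = sum λ (k : Fin (suc n)) →
    recip (toℕ k !) {{toℕ k !≢0}} * (g ^⊛ toℕ k) n

  cx+x²/2 : Carrier → PowerSeries
  cx+x²/2 c 1 = c
  cx+x²/2 c 2 = recip 2
  cx+x²/2 c _ = 0#

  -- The aₙ with f = Σ aₙ xⁿ / n!.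
  egfCoeff : PowerSeries → ℕ → Carrier
  egfCoeff f n = (n !) · f n

  dilatedHankel : ℕ → PowerSeries → Carrier
  dilatedHankel n f =
    det {n} λ i j → egfCoeff f (2 ℕ.* toℕ i ℕ.+ toℕ j)

{-# OPTIONS --safe #-}

-- Write w = x² + 2cx = (x + c)² - c², so that w′ = 2(x + c) and f′ = (x + c) f.
-- Hence (wᵏ f)″ is wᵏ⁺¹ f plus a combination of f, w f, …, wᵏ f, and therefore
-- f⁽²ⁱ⁾ is wⁱ f plus a combination of the wᵏ f with k < i.  Row i of the dilated
-- Hankel matrix lists the Taylor coefficients (in xʲ/j!) of f⁽²ⁱ⁾, so subtracting
-- multiples of earlier rows replaces it by those of wⁱ f, which vanish for j < i
-- and equal (2c)ⁱ i! for j = i: the matrix becomes upper triangular.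

module Submission where

open import Defs
open import Algebra.Apartness.Bundles using (HeytingField)
open import Algebra.Bundles using (CommutativeRing; Monoid)
open import Data.Fin.Base using (Fin; zero; suc; toℕ)
open import Data.List.Base using (List; []; _∷_; tabulate)
open import Data.Nat.Base as ℕ using (ℕ; zero; suc; _∸_; _≤_; _<_; _≥_; s≤s; _!; NonZero)
open import Data.Nat.Combinatorics
  using (_C_; nC1≡n; nCk+nC[k+1]≡[n+1]C[k+1]; k>n⇒nCk≡0)
import Data.Nat.Properties as ℕ
open import Data.Nat.Properties using (_!≢0)
open import Data.Nat.Tactic.RingSolver using (solve-∀)
open import Data.Product.Base using (_×_; _,_; ∃-syntax; proj₁; proj₂)
open import Data.Sum.Base using (inj₁; inj₂)
open import Data.Vec.Functional using (Vector; removeAt)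
open import Function.Base using (_∘_)
open import Level using (_⊔_)
open import Relation.Binary.PropositionalEquality as ≡ using (_≡_)
open import Relation.Nullary.Decidable.Core using (yes; no)
import Algebra.Definitions.RawMonoid as RawMonoidDefs
import Algebra.Properties.Monoid.Sum as MonoidSum
import Algebra.Properties.Ring as RingProperties
import Algebra.Properties.Semiring.Exp as SemiringExp
import Algebra.Properties.Semiring.Mult as SemiringMult
import Algebra.Properties.Semiring.Sum as SemiringSum
import Algebra.Solver.Ring.NaturalCoefficients.Default as NatCoeffSolver
import Relation.Binary.Reasoning.Setoid as SetoidReasoning

-- The dilation by 2 is what makes the reduction close up. One derivative leaves the span of the wᵏ
-- f, because (wᵏ f)′ = (x + c)(wᵏ + 2k wᵏ⁻¹) f; only the square of the stray factor, (x + c)² = w +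
-- c², is again a polynomial in w. A first derivative is therefore recorded as x + c times an
-- element of the span, and this is applied twice. Row operations are justified without
-- permutations: expansion along a row is an operator on functions of column lists, such operators
-- anticommute and square to zero, so a row may be changed by combinations of the rows above it. The
-- equation f′ = (x + c) f also settles the closed form of aₙ, since together with the constant term
-- it determines the series. For the exponential it is derived with x d/dx in place of d/dx, which
-- keeps degrees fixed and turns the power rule for gᵏ into an identity between coefficients of the
-- same index.

-- Laplace expansion and row operations

module LaplaceExpansion {a ℓ} (R : CommutativeRing a ℓ) {x} (X : Set x) where

  open CommutativeRing R hiding (zero)
  open Determinant R
  open SemiringSum semiring
  open SemiringExp semiring using (_^_)
  open NatCoeffSolver commutativeSemiring
  open SetoidReasoning setoid

  private
    Row : Set _
    Row = X → Carrier

    Minor : Set _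
    Minor = List X → Carrier

    -- A named sign: the semiring solver treats it as a variable, and `1+σ≈0` is the only property
    -- specific to it.
    σ : Carrier
    σ = - 1#

    1+σ≈0 : 1# + σ ≈ 0#
    1+σ≈0 = -‿inverseʳ 1#

  -- Laplace expansion along the row r; F gives the complementary minors as a
  -- function of the list of their columns.
  expand : Row → Minor → Minor
  expand r F []       = 0#
  expand r F (x ∷ xs) = r x * F xs + σ * expand r (F ∘ (x ∷_)) xs

  expand-cong : ∀ {r s F G} → (∀ x → r x ≈ s x) → (∀ xs → F xs ≈ G xs) →
                ∀ xs → expand r F xs ≈ expand s G xs
  expand-cong r≈s F≈G []       = refl
  expand-cong r≈s F≈G (x ∷ xs) =
    +-cong (*-cong (r≈s x) (F≈G xs))
           (*-congˡ (expand-cong r≈s (F≈G ∘ (x ∷_)) xs))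

  expand-linearʳ : ∀ r p F q G xs →
    expand r (λ ys → p * F ys + q * G ys) xs ≈ p * expand r F xs + q * expand r G xs
  expand-linearʳ r p F q G [] =
    solve 2 (λ p q → con 0 := p :* con 0 :+ q :* con 0) refl p q
  expand-linearʳ r p F q G (x ∷ xs) = begin
    r x * (p * F xs + q * G xs) + σ * expand r _ xs
      ≈⟨ +-congˡ (*-congˡ (expand-linearʳ r p _ q _ xs)) ⟩
    r x * (p * F xs + q * G xs) + σ * (p * F′ + q * G′)
      ≈⟨ solve 8 (λ r p q s f g f′ g′ →
           r :* (p :* f :+ q :* g) :+ s :* (p :* f′ :+ q :* g′) :=
           p :* (r :* f :+ s :* f′) :+ q :* (r :* g :+ s :* g′))
           refl (r x) p q σ (F xs) (G xs) F′ G′ ⟩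
    p * (r x * F xs + σ * F′) + q * (r x * G xs + σ * G′) ∎
    where
    F′ = expand r (F ∘ (x ∷_)) xs
    G′ = expand r (G ∘ (x ∷_)) xs

  expand-+ˡ : ∀ r s F xs →
    expand (λ x → r x + s x) F xs ≈ expand r F xs + expand s F xs
  expand-+ˡ r s F []       = sym (+-identityˡ 0#)
  expand-+ˡ r s F (x ∷ xs) = trans
    (+-congˡ (*-congˡ (expand-+ˡ r s _ xs)))
    (solve 6 (λ r s t f g h →
      (r :+ s) :* f :+ t :* (g :+ h) := (r :* f :+ t :* g) :+ (s :* f :+ t :* h))
      refl (r x) (s x) σ (F xs) _ _)

  expand-*ˡ : ∀ p r F xs → expand (λ x → p * r x) F xs ≈ p * expand r F xs
  expand-*ˡ p r F []       = sym (zeroʳ p)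
  expand-*ˡ p r F (x ∷ xs) = trans
    (+-congˡ (*-congˡ (expand-*ˡ p r _ xs)))
    (solve 5 (λ p r t f g →
      (p :* r) :* f :+ t :* (p :* g) := p :* (r :* f :+ t :* g))
      refl p (r x) σ (F xs) _)

  expand-0ˡ : ∀ F xs → expand (λ _ → 0#) F xs ≈ 0#
  expand-0ˡ F xs = trans
    (expand-cong (λ _ → sym (zeroˡ 0#)) (λ _ → refl) xs)
    (trans (expand-*ˡ 0# (λ _ → 0#) F xs) (zeroˡ _))

  expand-0ʳ : ∀ r {F} → (∀ xs → F xs ≈ 0#) → ∀ xs → expand r F xs ≈ 0#
  expand-0ʳ r F≈0 []       = refl
  expand-0ʳ r F≈0 (x ∷ xs) = trans
    (+-cong (*-congˡ (F≈0 xs)) (*-congˡ (expand-0ʳ r (F≈0 ∘ (x ∷_)) xs)))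
    (solve 2 (λ r t → r :* con 0 :+ t :* con 0 := con 0) refl (r x) σ)

  -- The head column can be chosen in the outer or in the inner expansion, with opposite signs. This
  -- does not follow from `expand-anticomm`, which for equal rows only says that twice the value
  -- vanishes.
  expand-alternating : ∀ r F xs → expand r (expand r F) xs ≈ 0#
  expand-alternating r F []       = refl
  expand-alternating r F (x ∷ xs) = begin
    r x * A + σ * expand r (λ ys → r x * F ys + σ * expand r F′ ys) xs
      ≈⟨ +-congˡ (*-congˡ (expand-linearʳ r (r x) F σ (expand r F′) xs)) ⟩
    r x * A + σ * (r x * A + σ * expand r (expand r F′) xs)
      ≈⟨ +-congˡ (*-congˡ (+-congˡ (*-congˡ (expand-alternating r F′ xs)))) ⟩
    r x * A + σ * (r x * A + σ * 0#)
      ≈⟨ solve 3 (λ r a t →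
           r :* a :+ t :* (r :* a :+ t :* con 0) := (con 1 :+ t) :* (r :* a))
           refl (r x) A σ ⟩
    (1# + σ) * (r x * A)
      ≈⟨ trans (*-congʳ 1+σ≈0) (zeroˡ _) ⟩
    0# ∎
    where
    A = expand r F xs
    F′ = F ∘ (x ∷_)

  -- Terms that use the head column once cancel in pairs; terms that skip it twice carry σ² and fall
  -- to the induction.
  expand-anticomm : ∀ r s F xs →
    expand r (expand s F) xs + expand s (expand r F) xs ≈ 0#
  expand-anticomm r s F []       = +-identityˡ 0#
  expand-anticomm r s F (x ∷ xs) = begin
    (r x * B + σ * expand r (λ ys → s x * F ys + σ * expand s F′ ys) xs) +
    (s x * A + σ * expand s (λ ys → r x * F ys + σ * expand r F′ ys) xs)
      ≈⟨ +-cong (+-congˡ (*-congˡ (expand-linearʳ r (s x) F σ (expand s F′) xs)))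
                (+-congˡ (*-congˡ (expand-linearʳ s (r x) F σ (expand r F′) xs))) ⟩
    (r x * B + σ * (s x * A + σ * P)) + (s x * A + σ * (r x * B + σ * Q))
      ≈⟨ solve 5 (λ u v p q t →
           (u :+ t :* (v :+ t :* p)) :+ (v :+ t :* (u :+ t :* q)) :=
           (con 1 :+ t) :* (u :+ v) :+ t :* t :* (p :+ q))
           refl (r x * B) (s x * A) P Q σ ⟩
    (1# + σ) * (r x * B + s x * A) + σ * σ * (P + Q)
      ≈⟨ +-cong (*-congʳ 1+σ≈0) (*-congˡ (expand-anticomm r s F′ xs)) ⟩
    0# * (r x * B + s x * A) + σ * σ * 0#
      ≈⟨ trans (+-cong (zeroˡ _) (zeroʳ _)) (+-identityˡ 0#) ⟩
    0# ∎
    where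
    A = expand r F xs
    B = expand s F xs
    F′ = F ∘ (x ∷_)
    P = expand r (expand s F′) xs
    Q = expand s (expand r F′) xs

  -- Each skipped column contributes one factor σ, so the nested recursion unrolls to the signed sum
  -- that defines `det`.
  expand-sum : ∀ n r F (v : Vector X (suc n)) →
    expand r F (tabulate v) ≈
    sum λ j → σ ^ toℕ j * (r (v j) * F (tabulate (removeAt v j)))
  expand-sum zero    r F v = solve 2 (λ p t →
    p :+ t :* con 0 := con 1 :* p :+ con 0) refl (r (v zero) * F []) σ
  expand-sum (suc n) r F v = begin
    r (v zero) * F (tabulate (v ∘ suc)) + σ * expand r F′ (tabulate (v ∘ suc))
      ≈⟨ +-cong (sym (*-identityˡ _)) (*-congˡ (expand-sum n r F′ (v ∘ suc))) ⟩
    1# * (r (v zero) * F (tabulate (v ∘ suc))) + σ * sum t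
      ≈⟨ +-congˡ (*-distribˡ-sum σ t) ⟩
    1# * (r (v zero) * F (tabulate (v ∘ suc))) + sum (λ j → σ * t j)
      ≈⟨ +-congˡ (sum-cong-≋ {suc n} (λ j → sym (*-assoc σ (σ ^ toℕ j)
           (r (v (suc j)) * F′ (tabulate (removeAt (v ∘ suc) j)))))) ⟩
    1# * (r (v zero) * F (tabulate (v ∘ suc))) +
      sum (λ j → σ ^ suc (toℕ j) * (r (v (suc j)) * F (tabulate (removeAt v (suc j))))) ∎
    where
    F′ = F ∘ (v zero ∷_)
    t : Vector Carrier (suc n)
    t j = σ ^ toℕ j * (r (v (suc j)) * F′ (tabulate (removeAt (v ∘ suc) j)))

  -- The value 0 on leftover columns lets `minor-zero-column` hold without any condition on lengths.
  emptyMinor : Minor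
  emptyMinor []      = 1#
  emptyMinor (_ ∷ _) = 0#

  minor : (ℕ → Row) → ℕ → ℕ → Minor
  minor u k zero    = emptyMinor
  minor u k (suc m) = expand (u k) (minor u (suc k) m)

  -- The starting row and the column labels are general because each expansion drops the first row
  -- and one arbitrary column.
  det≈minor : ∀ {n} (A : Vector (Vector Carrier n) n) (u : ℕ → Row) k (v : Vector X n) →
    (∀ i j → A i j ≈ u (k ℕ.+ toℕ i) (v j)) → det A ≈ minor u k n (tabulate v)
  det≈minor {zero}  A u k v A≈u = refl
  det≈minor {suc n} A u k v A≈u = trans
    (sum-cong-≋ {suc n} λ j → *-congˡ {σ ^ toℕ j} (*-cong
      (trans (A≈u zero j) (reflexive (≡.cong (λ i → u i (v j)) (ℕ.+-identityʳ k))))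
      (det≈minor _ u (suc k) (removeAt v j) λ i l →
        trans (A≈u (suc i) _)
          (reflexive (≡.cong (λ i → u i (removeAt v j l)) (ℕ.+-suc k (toℕ i)))))))
    (sym (expand-sum n (u k) (minor u (suc k) n) v))

  infixl 6 _⊕_
  infixr 7 _⊙_

  _⊕_ : Row → Row → Row
  (r ⊕ s) x = r x + s x

  _⊙_ : Carrier → Row → Row
  (p ⊙ r) x = p * r x

  -- Membership is generated by closure rules instead of coefficient vectors, so that facts about
  -- linear operators become structural recursions; `respˢ` is there because rows are compared
  -- pointwise.
  data Span (u : ℕ → Row) (k : ℕ) : Row → Set (a ⊔ ℓ ⊔ x) where
    basis : ∀ {j} → j < k → Span u k (u j)
    0ˢ    : Span u k (λ _ → 0#)
    _+ˢ_  : ∀ {r s} → Span u k r → Span u k s → Span u k (r ⊕ s)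
    _*ˢ_  : ∀ p {r} → Span u k r → Span u k (p ⊙ r)
    respˢ : ∀ {r s} → (∀ x → r x ≈ s x) → Span u k r → Span u k s

  Monic : (ℕ → Row) → ℕ → Row → Set _
  Monic u k r = ∃[ s ] Span u k s × (∀ x → r x ≈ u k x + s x)

  -- The expansions along u 0, ..., u (k - 1), with u 0 outermost: the part of the matrix already
  -- reduced, with F standing for the rows below.
  leading : (ℕ → Row) → ℕ → Minor → Minor
  leading u zero    F = F
  leading u (suc k) F = leading u k (expand (u k) F)

  leading-cong : ∀ u k {F G} → (∀ xs → F xs ≈ G xs) →
                 ∀ xs → leading u k F xs ≈ leading u k G xs
  leading-cong u zero    F≈G = F≈G
  leading-cong u (suc k) F≈G = leading-cong u k (expand-cong (λ _ → refl) F≈G)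

  leading-linear : ∀ u k p F q G xs →
    leading u k (λ ys → p * F ys + q * G ys) xs ≈ p * leading u k F xs + q * leading u k G xs
  leading-linear u zero    p F q G xs = refl
  leading-linear u (suc k) p F q G xs = trans
    (leading-cong u k (expand-linearʳ (u k) p F q G) xs)
    (leading-linear u k p _ q _ xs)

  leading-+ : ∀ u k F G xs →
    leading u k (λ ys → F ys + G ys) xs ≈ leading u k F xs + leading u k G xs
  leading-+ u k F G xs = begin
    leading u k (λ ys → F ys + G ys) xs
      ≈⟨ leading-cong u k (λ ys → +-cong (*-identityˡ _) (*-identityˡ _)) xs ⟨
    leading u k (λ ys → 1# * F ys + 1# * G ys) xs
      ≈⟨ leading-linear u k 1# F 1# G xs ⟩
    1# * leading u k F xs + 1# * leading u k G xs
      ≈⟨ +-cong (*-identityˡ _) (*-identityˡ _) ⟩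
    leading u k F xs + leading u k G xs ∎

  leading-* : ∀ u k p F xs → leading u k (λ ys → p * F ys) xs ≈ p * leading u k F xs
  leading-* u k p F xs = begin
    leading u k (λ ys → p * F ys) xs
      ≈⟨ leading-cong u k (λ ys → trans (+-congˡ (zeroˡ _)) (+-identityʳ _)) xs ⟨
    leading u k (λ ys → p * F ys + 0# * F ys) xs
      ≈⟨ leading-linear u k p F 0# F xs ⟩
    p * leading u k F xs + 0# * leading u k F xs
      ≈⟨ trans (+-congˡ (zeroˡ _)) (+-identityʳ _) ⟩
    p * leading u k F xs ∎

  leading-0 : ∀ u k {F} → (∀ xs → F xs ≈ 0#) → ∀ xs → leading u k F xs ≈ 0#
  leading-0 u zero    F≈0 = F≈0
  leading-0 u (suc k) F≈0 = leading-0 u k (expand-0ʳ (u k) F≈0)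

  -- The repeated row is moved outwards past u k, at the cost of a sign, until it meets its copy and
  -- `expand-alternating` applies.
  leading-repeated : ∀ u {k j} → j < k → ∀ F xs → leading u k (expand (u j) F) xs ≈ 0#
  leading-repeated u {suc k} {j} (s≤s j≤k) F xs with ℕ.m≤n⇒m<n∨m≡n j≤k
  ... | inj₂ ≡.refl = leading-0 u k (expand-alternating (u k) F) xs
  ... | inj₁ j<k    = begin
    leading u k EkEj xs
      ≈⟨ trans (+-congˡ (leading-repeated u j<k (expand (u k) F) xs)) (+-identityʳ _) ⟨
    leading u k EkEj xs + leading u k EjEk xs
      ≈⟨ leading-+ u k EkEj EjEk xs ⟨
    leading u k (λ ys → EkEj ys + EjEk ys) xs
      ≈⟨ leading-0 u k (expand-anticomm (u k) (u j) F) xs ⟩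
    0# ∎
    where
    EkEj = expand (u k) (expand (u j) F)
    EjEk = expand (u j) (expand (u k) F)

  leading-span : ∀ u k {s} → Span u k s → ∀ F xs → leading u k (expand s F) xs ≈ 0#
  leading-span u k (basis j<k) F xs = leading-repeated u j<k F xs
  leading-span u k 0ˢ          F xs = leading-0 u k (expand-0ˡ F) xs
  leading-span u k (_+ˢ_ {r} {s} R S) F xs = begin
    leading u k (expand (r ⊕ s) F) xs
      ≈⟨ leading-cong u k (expand-+ˡ r s F) xs ⟩
    leading u k (λ ys → expand r F ys + expand s F ys) xs
      ≈⟨ leading-+ u k (expand r F) (expand s F) xs ⟩
    leading u k (expand r F) xs + leading u k (expand s F) xs
      ≈⟨ +-cong (leading-span u k R F xs) (leading-span u k S F xs) ⟩
    0# + 0#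
      ≈⟨ +-identityˡ 0# ⟩
    0# ∎
  leading-span u k (_*ˢ_ p {r} R) F xs = begin
    leading u k (expand (p ⊙ r) F) xs
      ≈⟨ leading-cong u k (expand-*ˡ p r F) xs ⟩
    leading u k (λ ys → p * expand r F ys) xs
      ≈⟨ leading-* u k p (expand r F) xs ⟩
    p * leading u k (expand r F) xs
      ≈⟨ trans (*-congˡ (leading-span u k R F xs)) (zeroʳ p) ⟩
    0# ∎

  leading-span u k (respˢ r≈s R) F xs = trans
    (leading-cong u k (expand-cong (λ x → sym (r≈s x)) (λ _ → refl)) xs)
    (leading-span u k R F xs)

  -- Rows are replaced from the top. When row k is reached, those above it are already the u j with
  -- j < k, so its correction is a combination of them and contributes nothing.
  leading-minor-monic : ∀ {r u} → (∀ k → Monic u k (r k)) →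
    ∀ k m xs → leading u k (minor r k m) xs ≈ leading u k (minor u k m) xs
  leading-minor-monic             monic k zero    xs = refl
  leading-minor-monic {r} {u} monic k (suc m) xs with monic k
  ... | s , s∈ , r≈u+s = begin
    leading u k (expand (r k) F) xs
      ≈⟨ leading-cong u k (expand-cong r≈u+s (λ _ → refl)) xs ⟩
    leading u k (expand (u k ⊕ s) F) xs
      ≈⟨ leading-cong u k (expand-+ˡ (u k) s F) xs ⟩
    leading u k (λ ys → expand (u k) F ys + expand s F ys) xs
      ≈⟨ leading-+ u k (expand (u k) F) (expand s F) xs ⟩
    leading u k (expand (u k) F) xs + leading u k (expand s F) xs
      ≈⟨ trans (+-congˡ (leading-span u k s∈ F xs)) (+-identityʳ _) ⟩
    leading u (suc k) F xs
      ≈⟨ leading-minor-monic monic (suc k) m xs ⟩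
    leading u k (minor u k (suc m)) xs ∎
    where F = minor r (suc k) m

  -- Every expansion either takes the column x, with coefficient 0, or keeps it in front; if it is
  -- never taken, it remains when the rows run out.
  minor-zero-column : ∀ u k m x → (∀ {j} → k ≤ j → u j x ≈ 0#) →
                      ∀ xs → minor u k m (x ∷ xs) ≈ 0#
  minor-zero-column u k zero    x u≈0 xs = refl
  minor-zero-column u k (suc m) x u≈0 xs = begin
    u k x * F xs + σ * expand (u k) (F ∘ (x ∷_)) xs
      ≈⟨ +-cong (*-congʳ (u≈0 ℕ.≤-refl)) (*-congˡ (expand-0ʳ (u k)
           (minor-zero-column u (suc k) m x (u≈0 ∘ ℕ.<⇒≤)) xs)) ⟩
    0# * F xs + σ * 0#
      ≈⟨ trans (+-cong (zeroˡ _) (zeroʳ _)) (+-identityˡ 0#) ⟩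
    0# ∎
    where F = minor u (suc k) m

-- Determinants of triangular matrices

module TriangularDeterminant {a ℓ} (R : CommutativeRing a ℓ) where

  open CommutativeRing R hiding (zero)
  open Determinant R
  open LaplaceExpansion R ℕ
  open SetoidReasoning setoid
  open RawMonoidDefs *-rawMonoid using () renaming (sum to product)

  -- Choosing any column but the first leaves `v₀` to the later rows, all of which vanish there, so
  -- only the diagonal term survives.
  minor-triangular : ∀ u → (∀ {k j} → j < k → u k j ≈ 0#) →
    ∀ k m (v : Vector ℕ m) → (∀ i → v i ≡ k ℕ.+ toℕ i) →
    minor u k m (tabulate v) ≈ product λ i → u (v i) (v i)
  minor-triangular u u≈0 k zero    v v≡ = refl
  minor-triangular u u≈0 k (suc m) v v≡ = begin
    u k v₀ * F xs + - 1# * expand (u k) (F ∘ (v₀ ∷_)) xs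
      ≈⟨ +-cong (*-cong (reflexive (≡.cong (λ k → u k v₀) (≡.sym v₀≡k)))
                        (minor-triangular u u≈0 (suc k) m (v ∘ suc)
                          (λ i → ≡.trans (v≡ (suc i)) (ℕ.+-suc k (toℕ i)))))
                (*-congˡ (expand-0ʳ (u k) (minor-zero-column u (suc k) m v₀
                  (λ k<j → u≈0 (≡.subst (_< _) (≡.sym v₀≡k) k<j))) xs)) ⟩
    u v₀ v₀ * product (λ i → u (v (suc i)) (v (suc i))) + - 1# * 0#
      ≈⟨ trans (+-congˡ (zeroʳ _)) (+-identityʳ _) ⟩
    u v₀ v₀ * product (λ i → u (v (suc i)) (v (suc i))) ∎
    where
    v₀ = v zero
    v₀≡k = ≡.trans (v≡ zero) (ℕ.+-identityʳ k)
    F = minor u (suc k) m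
    xs = tabulate (v ∘ suc)

  -- The hypotheses say r = L u with L unit lower and u upper triangular.
  det-LU : ∀ r u → (∀ k → Monic u k (r k)) → (∀ {k j} → j < k → u k j ≈ 0#) →
    ∀ n → det {n} (λ i j → r (toℕ i) (toℕ j)) ≈ product {n} λ i → u (toℕ i) (toℕ i)
  det-LU r u monic u≈0 n = begin
    det {n} (λ i j → r (toℕ i) (toℕ j))  ≈⟨ det≈minor {n} _ r 0 toℕ (λ _ _ → refl) ⟩
    minor r 0 n (tabulate {n = n} toℕ)   ≈⟨ leading-minor-monic monic 0 n _ ⟩
    minor u 0 n (tabulate {n = n} toℕ)   ≈⟨ minor-triangular u u≈0 0 n toℕ (λ _ → ≡.refl) ⟩
    product {n} (λ i → u (toℕ i) (toℕ i)) ∎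

-- Differential operators on exponential coefficient sequences

-- A sequence h stands for Σ hₙ xⁿ/n!.  On these series D is d/dx, X, Y and W
-- are multiplication by x, x + c and x² + 2cx = (x + c)² - c².
module Operators {a ℓ} (R : CommutativeRing a ℓ) (c : CommutativeRing.Carrier R) where

  open CommutativeRing R hiding (zero)
  open LaplaceExpansion R ℕ
  open SemiringExp semiring using (_^_)
  open SemiringMult semiring using (×1-homo-*) renaming (_×_ to _·_)
  open NatCoeffSolver commutativeSemiring
  open SetoidReasoning setoid

  Seq : Set a
  Seq = ℕ → Carrier

  infix 4 _≋_

  _≋_ : Seq → Seq → Set ℓ
  f ≋ g = ∀ n → f n ≈ g n

  D X Y W : Seq → Seq
  D h n       = h (suc n)
  X h zero    = 0#
  -- The factor comes from x · xⁿ/n! = (n + 1) xⁿ⁺¹/(n + 1)!.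
  X h (suc n) = (suc n · 1#) * h n
  Y h         = X h ⊕ c ⊙ h
  W h         = X (X h) ⊕ (c + c) ⊙ X h

  X-cong : ∀ {f g} → f ≋ g → X f ≋ X g
  X-cong f≋g zero    = refl
  X-cong f≋g (suc n) = *-congˡ (f≋g n)

  X-⊕ : ∀ f g → X (f ⊕ g) ≋ X f ⊕ X g
  X-⊕ f g zero    = sym (+-identityˡ 0#)
  X-⊕ f g (suc n) = distribˡ _ _ _

  X-⊙ : ∀ p f → X (p ⊙ f) ≋ p ⊙ X f
  X-⊙ p f zero    = sym (zeroʳ p)
  X-⊙ p f (suc n) = solve 3 (λ p m x → m :* (p :* x) := p :* (m :* x)) refl p (suc n · 1#) (f n)

  Y-cong : ∀ {f g} → f ≋ g → Y f ≋ Y g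
  Y-cong f≋g n = +-cong (X-cong f≋g n) (*-congˡ (f≋g n))

  Y-⊕ : ∀ f g → Y (f ⊕ g) ≋ Y f ⊕ Y g
  Y-⊕ f g n = trans (+-congʳ (X-⊕ f g n))
    (solve 5 (λ c x y x′ y′ → (x :+ y) :+ c :* (x′ :+ y′) := (x :+ c :* x′) :+ (y :+ c :* y′))
      refl c (X f n) (X g n) (f n) (g n))

  Y-⊙ : ∀ p f → Y (p ⊙ f) ≋ p ⊙ Y f
  Y-⊙ p f n = trans (+-congʳ (X-⊙ p f n))
    (solve 4 (λ c p x x′ → p :* x :+ c :* (p :* x′) := p :* (x :+ c :* x′))
      refl c p (X f n) (f n))

  XX-⊕ : ∀ f g → X (X (f ⊕ g)) ≋ X (X f) ⊕ X (X g)
  XX-⊕ f g n = trans (X-cong (X-⊕ f g) n) (X-⊕ (X f) (X g) n)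

  XX-⊙ : ∀ p f → X (X (p ⊙ f)) ≋ p ⊙ X (X f)
  XX-⊙ p f n = trans (X-cong (X-⊙ p f) n) (X-⊙ p (X f) n)

  W-cong : ∀ {f g} → f ≋ g → W f ≋ W g
  W-cong f≋g n = +-cong (X-cong (X-cong f≋g) n) (*-congˡ (X-cong f≋g n))

  W-⊕ : ∀ f g → W (f ⊕ g) ≋ W f ⊕ W g
  W-⊕ f g n = trans (+-cong (XX-⊕ f g n) (*-congˡ (X-⊕ f g n)))
    (solve 5 (λ c x y x′ y′ → (x :+ y) :+ c :* (x′ :+ y′) := (x :+ c :* x′) :+ (y :+ c :* y′))
      refl (c + c) (X (X f) n) (X (X g) n) (X f n) (X g n))

  W-⊙ : ∀ p f → W (p ⊙ f) ≋ p ⊙ W f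
  W-⊙ p f n = trans (+-cong (XX-⊙ p f n) (*-congˡ (X-⊙ p f n)))
    (solve 4 (λ c p x x′ → p :* x :+ c :* (p :* x′) := p :* (x :+ c :* x′))
      refl (c + c) p (X (X f) n) (X f n))

  X-Y : ∀ h → X (Y h) ≋ Y (X h)
  X-Y h n = trans (X-⊕ (X h) (c ⊙ h) n) (+-congˡ (X-⊙ c h n))

  W-Y : ∀ h → W (Y h) ≋ Y (W h)
  W-Y h n = begin
    X (X (Y h)) n + (c + c) * X (Y h) n
      ≈⟨ +-cong (trans (X-cong (X-Y h) n) (X-Y (X h) n)) (*-congˡ (X-Y h n)) ⟩
    Y (X (X h)) n + (c + c) * Y (X h) n
      ≈⟨ +-congˡ (Y-⊙ (c + c) (X h) n) ⟨
    Y (X (X h)) n + Y ((c + c) ⊙ X h) n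
      ≈⟨ Y-⊕ (X (X h)) ((c + c) ⊙ X h) n ⟨
    Y (W h) n ∎

  Y-Y : ∀ h → Y (Y h) ≋ W h ⊕ (c * c) ⊙ h
  Y-Y h n = trans (+-congʳ (X-Y h n))
    (solve 4 (λ c x y z →
      (x :+ c :* y) :+ c :* (y :+ c :* z) := (x :+ (c :+ c) :* y) :+ (c :* c) :* z)
      refl c (X (X h) n) (X h n) (h n))

  D-X : ∀ h → D (X h) ≋ h ⊕ X (D h)
  D-X h zero    = solve 1 (λ x → (con 1 :+ con 0) :* x := x :+ con 0) refl (h 0)
  D-X h (suc n) = solve 2 (λ m x → (con 1 :+ m) :* x := x :+ m :* x)
    refl (suc n · 1#) (h (suc n))

  D-Y : ∀ h → D (Y h) ≋ h ⊕ Y (D h)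
  D-Y h n = trans (+-congʳ (D-X h n)) (+-assoc _ _ _)

  D-W : ∀ h → D (W h) ≋ W (D h) ⊕ (Y h ⊕ Y h)
  D-W h n = begin
    D (X (X h)) n + (c + c) * D (X h) n
      ≈⟨ +-cong (trans (D-X (X h) n) (+-congˡ (trans (X-cong (D-X h) n) (X-⊕ h (X (D h)) n))))
                (*-congˡ (D-X h n)) ⟩
    (X h n + (X h n + X (X (D h)) n)) + (c + c) * (h n + X (D h) n)
      ≈⟨ solve 5 (λ c x y z w →
           (x :+ (x :+ y)) :+ (c :+ c) :* (z :+ w) :=
           (y :+ (c :+ c) :* w) :+ ((x :+ c :* z) :+ (x :+ c :* z)))
           refl c (X h n) (X (X (D h)) n) (h n) (X (D h) n) ⟩
    W (D h) n + (Y h n + Y h n) ∎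

  X-0 : ∀ n → X (λ _ → 0#) n ≈ 0#
  X-0 zero    = refl
  X-0 (suc n) = zeroʳ _

  Y-0 : ∀ n → Y (λ _ → 0#) n ≈ 0#
  Y-0 n = trans (+-cong (X-0 n) (zeroʳ c)) (+-identityˡ 0#)

  W-0 : ∀ n → W (λ _ → 0#) n ≈ 0#
  W-0 n = trans
    (+-cong (trans (X-cong X-0 n) (X-0 n)) (trans (*-congˡ (X-0 n)) (zeroʳ _)))
    (+-identityˡ 0#)

  span-weaken : ∀ {u j k} → j ≤ k → ∀ {r} → Span u j r → Span u k r
  span-weaken j≤k (basis i<j)   = basis (ℕ.<-≤-trans i<j j≤k)
  span-weaken j≤k 0ˢ            = 0ˢ
  span-weaken j≤k (r +ˢ s)      = span-weaken j≤k r +ˢ span-weaken j≤k s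
  span-weaken j≤k (p *ˢ r)      = p *ˢ span-weaken j≤k r
  span-weaken j≤k (respˢ r≋s r) = respˢ r≋s (span-weaken j≤k r)

  monic⇒span : ∀ {u k r} → Monic u k r → Span u (suc k) r
  monic⇒span {k = k} (s , s∈ , r≋u+s) =
    respˢ (sym ∘ r≋u+s) (basis ℕ.≤-refl +ˢ span-weaken (ℕ.n≤1+n k) s∈)

  -- The egfs of these sequences are (x² + 2cx)ᵏ f(x).
  ladder : Seq → ℕ → Seq
  ladder f zero    = f
  ladder f (suc k) = W (ladder f k)

  module Ladder {f} (D-f : D f ≋ Y f) where

    u : ℕ → Seq
    u = ladder f

    W-span : ∀ {k r} → Span u k r → Span u (suc k) (W r)
    W-span (basis j<k)             = basis (s≤s j<k)
    W-span 0ˢ                      = respˢ (sym ∘ W-0) 0ˢ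
    W-span (_+ˢ_ {r} {s} r∈ s∈)    = respˢ (sym ∘ W-⊕ r s) (W-span r∈ +ˢ W-span s∈)
    W-span (_*ˢ_ p {r} r∈)         = respˢ (sym ∘ W-⊙ p r) (p *ˢ W-span r∈)
    W-span (respˢ r≋s r∈)          = respˢ (W-cong r≋s) (W-span r∈)

    W-monic : ∀ {k r} → Monic u k r → Monic u (suc k) (W r)
    W-monic {k} (s , s∈ , r≋u+s) =
      W s , W-span s∈ , λ n → trans (W-cong r≋u+s n) (W-⊕ (u k) s n)

    -- The element s is 2k wᵏ⁻¹ f. The recursion builds it without naming the coefficient k: s is
    -- multiplied by w and wᵏ f is added twice, from w′ = 2(x + c).
    D-u : ∀ k → ∃[ s ] Span u k s × D (u k) ≋ Y (u k ⊕ s)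
    D-u zero    = (λ _ → 0#) , 0ˢ , λ n →
      trans (D-f n) (Y-cong (λ n → sym (+-identityʳ (f n))) n)
    D-u (suc k) with D-u k
    ... | s , s∈ , Du≋Y[u+s] =
      W s ⊕ (u k ⊕ u k) ,
      W-span s∈ +ˢ (basis ℕ.≤-refl +ˢ basis ℕ.≤-refl) ,
      λ n → begin
        D (W (u k)) n
          ≈⟨ D-W (u k) n ⟩
        W (D (u k)) n + (Y (u k) n + Y (u k) n)
          ≈⟨ +-cong (trans (W-cong Du≋Y[u+s] n) (W-Y (u k ⊕ s) n)) (sym (Y-⊕ (u k) (u k) n)) ⟩
        Y (W (u k ⊕ s)) n + Y (u k ⊕ u k) n
          ≈⟨ Y-⊕ (W (u k ⊕ s)) (u k ⊕ u k) n ⟨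
        Y (W (u k ⊕ s) ⊕ (u k ⊕ u k)) n
          ≈⟨ Y-cong (λ n → trans (+-congʳ (W-⊕ (u k) s n)) (+-assoc _ _ _)) n ⟩
        Y (u (suc k) ⊕ (W s ⊕ (u k ⊕ u k))) n ∎

    D-span : ∀ {k r} → Span u k r → ∃[ s ] Span u k s × D r ≋ Y s
    D-span (basis {j} j<k) with D-u j
    ... | s , s∈ , Du≋Y[u+s] =
      u j ⊕ s , basis j<k +ˢ span-weaken (ℕ.<⇒≤ j<k) s∈ , Du≋Y[u+s]
    D-span 0ˢ = (λ _ → 0#) , 0ˢ , sym ∘ Y-0
    D-span (r∈ +ˢ r′∈) with D-span r∈ | D-span r′∈
    ... | s , s∈ , Dr≋Ys | s′ , s′∈ , Dr′≋Ys′ =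
      s ⊕ s′ , s∈ +ˢ s′∈ , λ n → trans (+-cong (Dr≋Ys n) (Dr′≋Ys′ n)) (sym (Y-⊕ s s′ n))
    D-span (p *ˢ r∈) with D-span r∈
    ... | s , s∈ , Dr≋Ys =
      p ⊙ s , p *ˢ s∈ , λ n → trans (*-congˡ (Dr≋Ys n)) (sym (Y-⊙ p s n))
    D-span (respˢ r≋r′ r∈) with D-span r∈
    ... | s , s∈ , Dr≋Ys = s , s∈ , λ n → trans (sym (r≋r′ (suc n))) (Dr≋Ys n)

    -- Differentiation preserves the leading term up to the factor x + c, so it can be applied a
    -- second time to the quotient s.
    D-monic : ∀ {k r} → Monic u k r → ∃[ s ] Monic u k s × D r ≋ Y s
    D-monic {k} (t , t∈ , r≋u+t) with D-u k | D-span t∈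
    ... | s , s∈ , Du≋Y[u+s] | s′ , s′∈ , Dt≋Ys′ =
      (u k ⊕ s) ⊕ s′ ,
      (s ⊕ s′ , s∈ +ˢ s′∈ , λ n → +-assoc _ _ _) ,
      λ n → trans (r≋u+t (suc n))
        (trans (+-cong (Du≋Y[u+s] n) (Dt≋Ys′ n)) (sym (Y-⊕ (u k ⊕ s) s′ n)))

    -- If D r = Y g and D g = Y h then D² r = g + Y² h = W h + (g + c² h).
    D²-monic : ∀ {k r} → Monic u k r → Monic u (suc k) (D (D r))
    D²-monic {k} {r} r-monic =
      let g , g-monic , Dr≋Yg = D-monic r-monic
          h , h-monic , Dg≋Yh = D-monic g-monic
          s , s∈ , Wh≋u+s     = W-monic h-monic
      in
      s ⊕ (g ⊕ (c * c) ⊙ h) ,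
      s∈ +ˢ (monic⇒span g-monic +ˢ ((c * c) *ˢ monic⇒span h-monic)) ,
      λ n → begin
        D (D r) n
          ≈⟨ Dr≋Yg (suc n) ⟩
        D (Y g) n
          ≈⟨ D-Y g n ⟩
        g n + Y (D g) n
          ≈⟨ +-congˡ (trans (Y-cong Dg≋Yh n) (Y-Y h n)) ⟩
        g n + (W h n + c * c * h n)
          ≈⟨ +-congˡ (+-congʳ (Wh≋u+s n)) ⟩
        g n + ((u (suc k) n + s n) + c * c * h n)
          ≈⟨ solve 4 (λ g u s h → g :+ ((u :+ s) :+ h) := u :+ (s :+ (g :+ h)))
               refl (g n) (u (suc k) n) (s n) (c * c * h n) ⟩
        u (suc k) n + (s n + (g n + c * c * h n)) ∎

    even-derivative-monic : ∀ k → Monic u k (λ n → f (2 ℕ.* k ℕ.+ n))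
    even-derivative-monic zero    = (λ _ → 0#) , 0ˢ , λ n → sym (+-identityʳ (f n))
    even-derivative-monic (suc k) =
      let s , s∈ , eq = D²-monic (even-derivative-monic k)
      in  s , s∈ , λ n → trans (reflexive (≡.cong f (shift k n))) (eq n)
      where
      shift : ∀ k n → 2 ℕ.* suc k ℕ.+ n ≡ 2 ℕ.* k ℕ.+ suc (suc n)
      shift k n = ≡.trans (≡.cong (ℕ._+ n) (ℕ.*-suc 2 k))
        (≡.sym (≡.trans (ℕ.+-suc (2 ℕ.* k) (suc n)) (≡.cong suc (ℕ.+-suc (2 ℕ.* k) n))))

  -- The factor x² + 2cx is divisible by x, so each multiplication raises the order of vanishing.
  ladder-below : ∀ f {k j} → j < k → ladder f k j ≈ 0#
  ladder-below f {suc k} {zero} _ =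
    trans (+-identityˡ _) (zeroʳ _)
  -- Degree 1 is separate: the x² part reaches `X` at index 0, which is 0 by definition.
  ladder-below f {suc k} {suc zero} (s≤s 0<k) = trans
    (+-cong (zeroʳ _) (*-congˡ (*-congˡ (ladder-below f 0<k))))
    (solve 2 (λ p q → con 0 :+ p :* (q :* con 0) := con 0) refl (c + c) (1 · 1#))
  ladder-below f {suc k} {suc (suc j)} (s≤s j<k) = trans
    (+-cong (*-congˡ (*-congˡ (ladder-below f (ℕ.<⇒≤ j<k))))
            (*-congˡ (*-congˡ (ladder-below f j<k))))
    (solve 3 (λ p q r → q :* (r :* con 0) :+ p :* (q :* con 0) := con 0)
      refl (c + c) (suc (suc j) · 1#) (suc j · 1#))

  -- Only 2cx contributes in the lowest degree, since x² meets a coefficient that vanishes. The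
  -- factorial accumulates from the factors in `X`.
  ladder-diagonal : ∀ f → f 0 ≈ 1# → ∀ k → ladder f k k ≈ (c + c) ^ k * ((k !) · 1#)
  ladder-diagonal f f₀≈1 zero    = trans f₀≈1 (solve 0 (con 1 := con 1 :* (con 1 :+ con 0)) refl)
  ladder-diagonal f f₀≈1 (suc k) = begin
    X (X u) (suc k) + (c + c) * ((suc k · 1#) * u k)
      ≈⟨ +-cong (*-congˡ (Xu k (λ j<k → ladder-below f j<k)))
                (*-congˡ (*-congˡ (ladder-diagonal f f₀≈1 k))) ⟩
    (suc k · 1#) * 0# + (c + c) * ((suc k · 1#) * ((c + c) ^ k * ((k !) · 1#)))
      ≈⟨ solve 4 (λ p m q n → m :* con 0 :+ p :* (m :* (q :* n)) := (p :* q) :* (m :* n))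
           refl (c + c) (suc k · 1#) ((c + c) ^ k) ((k !) · 1#) ⟩
    (c + c) ^ suc k * ((suc k · 1#) * ((k !) · 1#))
      ≈⟨ *-congˡ (×1-homo-* (suc k) (k !)) ⟨
    (c + c) ^ suc k * ((suc k !) · 1#) ∎
    where
    u = ladder f k
    Xu : ∀ k {u : Seq} → (∀ {j} → j < k → u j ≈ 0#) → X u k ≈ 0#
    Xu zero    u≈0 = refl
    Xu (suc k) u≈0 = trans (*-congˡ (u≈0 ℕ.≤-refl)) (zeroʳ _)

-- Finite sums, binomial coefficients and matchings

module _ {a ℓ} (M : Monoid a ℓ) where
  open Monoid M
  open MonoidSum M using (sum)

  -- Sums over `Fin` unfold from the front, whereas the inductions below append a last term; a
  -- general monoid covers both sums and products.
  sum-toℕ-last : ∀ (f : ℕ → Carrier) n →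
    sum {suc n} (f ∘ toℕ) ≈ sum {n} (f ∘ toℕ) ∙ f n
  sum-toℕ-last f zero    = trans (identityʳ _) (sym (identityˡ _))
  sum-toℕ-last f (suc n) =
    trans (∙-congˡ (sum-toℕ-last (f ∘ suc) n)) (sym (assoc _ _ _))

-- The absorption identity, by induction along Pascal's rule; with no quotient of factorials it also
-- covers k > n.
[k+1]*[n+1]C[k+1]≡[n+1]*nCk : ∀ n k → suc k ℕ.* (suc n C suc k) ≡ suc n ℕ.* (n C k)
[k+1]*[n+1]C[k+1]≡[n+1]*nCk n zero = begin
  1 ℕ.* (suc n C 1)  ≡⟨ ℕ.*-identityˡ _ ⟩
  suc n C 1          ≡⟨ nC1≡n (suc n) ⟩
  suc n              ≡⟨ ℕ.*-identityʳ (suc n) ⟨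
  suc n ℕ.* 1        ∎
  where open ≡.≡-Reasoning
[k+1]*[n+1]C[k+1]≡[n+1]*nCk zero (suc k) = ℕ.*-zeroʳ k
[k+1]*[n+1]C[k+1]≡[n+1]*nCk (suc n) (suc k) = begin
  suc (suc k) ℕ.* (suc (suc n) C suc (suc k))
    ≡⟨ ≡.cong (suc (suc k) ℕ.*_) (nCk+nC[k+1]≡[n+1]C[k+1] (suc n) (suc k)) ⟨
  suc (suc k) ℕ.* ((suc n C suc k) ℕ.+ (suc n C suc (suc k)))
    ≡⟨ distribute k (suc n C suc k) (suc n C suc (suc k)) ⟩
  (suc n C suc k) ℕ.+ suc k ℕ.* (suc n C suc k) ℕ.+ suc (suc k) ℕ.* (suc n C suc (suc k))
    ≡⟨ ≡.cong₂ (λ p q → (suc n C suc k) ℕ.+ p ℕ.+ q)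
         ([k+1]*[n+1]C[k+1]≡[n+1]*nCk n k) ([k+1]*[n+1]C[k+1]≡[n+1]*nCk n (suc k)) ⟩
  (suc n C suc k) ℕ.+ suc n ℕ.* (n C k) ℕ.+ suc n ℕ.* (n C suc k)
    ≡⟨ collect n (suc n C suc k) (n C k) (n C suc k) ⟩
  (suc n C suc k) ℕ.+ suc n ℕ.* ((n C k) ℕ.+ (n C suc k))
    ≡⟨ ≡.cong (λ p → (suc n C suc k) ℕ.+ suc n ℕ.* p) (nCk+nC[k+1]≡[n+1]C[k+1] n k) ⟩
  suc (suc n) ℕ.* (suc n C suc k) ∎
  where
  open ≡.≡-Reasoning
  distribute : ∀ k x y → suc (suc k) ℕ.* (x ℕ.+ y) ≡ x ℕ.+ suc k ℕ.* x ℕ.+ suc (suc k) ℕ.* y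
  distribute = solve-∀
  collect : ∀ n x y z → x ℕ.+ suc n ℕ.* y ℕ.+ suc n ℕ.* z ≡ x ℕ.+ suc n ℕ.* (y ℕ.+ z)
  collect = solve-∀

-- For even d, the number of matchings of n points that cover d of them.
matchings : ℕ → ℕ → ℕ
matchings n d = (n C d) ℕ.* (d ∸ 1) !!

-- At d = 0 truncated subtraction gives `0 !!`, which has the conventional value of (-1)!!.
[d+1]!!≡[d+1]*[d∸1]!! : ∀ d → suc d !! ≡ suc d ℕ.* (d ∸ 1) !!
[d+1]!!≡[d+1]*[d∸1]!! zero    = ≡.refl
[d+1]!!≡[d+1]*[d∸1]!! (suc d) = ≡.refl

-- For even d, single out one of the n + 2 points: it is matched with one of the n + 1 others, or it
-- is left uncovered. The algebra (Pascal and absorption) is uniform in d.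
matchings-step : ∀ n d →
  matchings (2 ℕ.+ n) (2 ℕ.+ d) ≡ suc n ℕ.* matchings n d ℕ.+ matchings (suc n) (2 ℕ.+ d)
matchings-step n d = begin
  (suc (suc n) C suc (suc d)) ℕ.* suc d !!
    ≡⟨ ≡.cong (ℕ._* suc d !!) (nCk+nC[k+1]≡[n+1]C[k+1] (suc n) (suc d)) ⟨
  ((suc n C suc d) ℕ.+ (suc n C suc (suc d))) ℕ.* suc d !!
    ≡⟨ ℕ.*-distribʳ-+ (suc d !!) (suc n C suc d) _ ⟩
  (suc n C suc d) ℕ.* suc d !! ℕ.+ matchings (suc n) (2 ℕ.+ d)
    ≡⟨ ≡.cong (ℕ._+ matchings (suc n) (2 ℕ.+ d)) absorb ⟩
  suc n ℕ.* matchings n d ℕ.+ matchings (suc n) (2 ℕ.+ d) ∎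
  where
  open ≡.≡-Reasoning
  swap : ∀ x y z → x ℕ.* (y ℕ.* z) ≡ y ℕ.* x ℕ.* z
  swap = solve-∀
  absorb : (suc n C suc d) ℕ.* suc d !! ≡ suc n ℕ.* matchings n d
  absorb = begin
    (suc n C suc d) ℕ.* suc d !!
      ≡⟨ ≡.cong ((suc n C suc d) ℕ.*_) ([d+1]!!≡[d+1]*[d∸1]!! d) ⟩
    (suc n C suc d) ℕ.* (suc d ℕ.* (d ∸ 1) !!)
      ≡⟨ swap (suc n C suc d) (suc d) _ ⟩
    suc d ℕ.* (suc n C suc d) ℕ.* (d ∸ 1) !!
      ≡⟨ ≡.cong (ℕ._* (d ∸ 1) !!) ([k+1]*[n+1]C[k+1]≡[n+1]*nCk n d) ⟩
    suc n ℕ.* (n C d) ℕ.* (d ∸ 1) !!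
      ≡⟨ ℕ.*-assoc (suc n) (n C d) _ ⟩
    suc n ℕ.* matchings n d ∎

matchings-zero : ∀ {n d} → n < d → matchings n d ≡ 0
matchings-zero {d = d} n<d = ≡.cong (ℕ._* (d ∸ 1) !!) (k>n⇒nCk≡0 n<d)

-- The explicit sum for aₙ and its recurrence

module HermiteSum {a ℓ} (R : CommutativeRing a ℓ) (c : CommutativeRing.Carrier R) where

  open CommutativeRing R hiding (zero)
  open Operators R c
  open SemiringExp semiring using (_^_; ^-homo-*)
  open RawMonoidDefs *-rawMonoid using () renaming (sum to product)
  open SemiringMult semiring
    using (×-assoc-*; ×-homo-+; ×-assocˡ; ×-congˡ; ×-congʳ; ×-comm-*) renaming (_×_ to _·_)
  open SemiringSum semiring using (sum; sum-cong-≋; ∑-distrib-+; *-distribˡ-sum)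
  open NatCoeffSolver commutativeSemiring
  open SetoidReasoning setoid

  ·≈·1* : ∀ n x → n · x ≈ (n · 1#) * x
  ·≈·1* n x = sym (trans (×-assoc-* n 1# x) (×-congʳ n (*-identityˡ x)))

  term : ℕ → ℕ → Carrier
  term n d = matchings n d · (c ^ (n ∸ d))

  term-zero : ∀ {n d} → n < d → term n d ≈ 0#
  term-zero n<d = ×-congˡ (matchings-zero n<d)

  -- For d < n a factor c splits off. Otherwise both truncated exponents are 0 and the powers do not
  -- match, but the matching number vanishes.
  term-power : ∀ n d → matchings (suc n) (2 ℕ.+ d) · (c ^ (n ∸ d)) ≈ c * term (suc n) (2 ℕ.+ d)
  term-power n d with d ℕ.<? n
  ... | yes d<n = begin
    m · (c ^ (n ∸ d))
      ≈⟨ ×-congʳ m (reflexive (≡.cong (c ^_) (ℕ.+-∸-assoc 1 d<n))) ⟩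
    m · (c * c ^ (n ∸ suc d))
      ≈⟨ ×-comm-* m c _ ⟨
    c * m · (c ^ (n ∸ suc d)) ∎
    where m = matchings (suc n) (2 ℕ.+ d)
  ... | no d≮n = begin
    matchings (suc n) (2 ℕ.+ d) · (c ^ (n ∸ d))
      ≈⟨ ×-congˡ (matchings-zero n<d) ⟩
    0#
      ≈⟨ zeroʳ c ⟨
    c * 0#
      ≈⟨ *-congˡ (term-zero n<d) ⟨
    c * term (suc n) (2 ℕ.+ d) ∎
    where n<d = s≤s (s≤s (ℕ.≮⇒≥ d≮n))

  term-step : ∀ n d →
    term (2 ℕ.+ n) (2 ℕ.+ d) ≈ (suc n · 1#) * term n d + c * term (suc n) (2 ℕ.+ d)
  term-step n d = begin
    matchings (2 ℕ.+ n) (2 ℕ.+ d) · (c ^ (n ∸ d))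
      ≈⟨ ×-congˡ (matchings-step n d) ⟩
    (suc n ℕ.* matchings n d ℕ.+ matchings (suc n) (2 ℕ.+ d)) · (c ^ (n ∸ d))
      ≈⟨ ×-homo-+ _ (suc n ℕ.* matchings n d) _ ⟩
    (suc n ℕ.* matchings n d) · (c ^ (n ∸ d)) + matchings (suc n) (2 ℕ.+ d) · (c ^ (n ∸ d))
      ≈⟨ +-cong (trans (sym (×-assocˡ _ (suc n) (matchings n d))) (·≈·1* (suc n) _))
                (term-power n d) ⟩
    (suc n · 1#) * term n d + c * term (suc n) (2 ℕ.+ d) ∎

  -- The number of summands is a parameter because the recurrence compares sums of different
  -- lengths; terms with 2j > n are zero.
  partialSum : ℕ → ℕ → Carrier
  partialSum n m = sum {m} λ j → term n (2 ℕ.* toℕ j)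

  hermite : Seq
  hermite n = partialSum n (suc n)

  hermite-extend : ∀ n → partialSum n (2 ℕ.+ n) ≈ hermite n
  hermite-extend n = trans
    (sum-toℕ-last +-monoid (λ j → term n (2 ℕ.* j)) (suc n))
    (trans (+-congˡ (term-zero (ℕ.m≤m+n (suc n) _))) (+-identityʳ _))

  -- The summand with no matched points only gains a factor c; every other one splits by
  -- `term-step`.
  D-hermite : D hermite ≋ Y hermite
  D-hermite zero    = solve 1 (λ c →
    (c :* con 1 :+ con 0) :+ (con 0 :+ con 0) :=
    con 0 :+ c :* ((con 1 :+ con 0) :+ con 0)) refl c
  D-hermite (suc n) = begin
    term (2 ℕ.+ n) 0 + sum (λ (j : Fin (2 ℕ.+ n)) → term (2 ℕ.+ n) (2 ℕ.* suc (toℕ j)))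
      ≈⟨ +-cong first (sum-cong-≋ {2 ℕ.+ n} λ j → rest (toℕ j)) ⟩
    c * term (suc n) 0 + sum (λ j → p * f j + c * g j)
      ≈⟨ +-congˡ (∑-distrib-+ (λ j → p * f j) (λ j → c * g j)) ⟩
    c * term (suc n) 0 + (sum (λ j → p * f j) + sum (λ j → c * g j))
      ≈⟨ +-congˡ (+-cong (*-distribˡ-sum p f) (*-distribˡ-sum c g)) ⟨
    c * term (suc n) 0 + (p * partialSum n (2 ℕ.+ n) + c * sum g)
      ≈⟨ solve 4 (λ c t x s → c :* t :+ (x :+ c :* s) := x :+ c :* (t :+ s))
           refl c (term (suc n) 0) (p * partialSum n (2 ℕ.+ n)) (sum g) ⟩
    p * partialSum n (2 ℕ.+ n) + c * partialSum (suc n) (3 ℕ.+ n)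
      ≈⟨ +-cong (*-congˡ (hermite-extend n)) (*-congˡ (hermite-extend (suc n))) ⟩
    p * hermite n + c * hermite (suc n) ∎
    where
    p = suc n · 1#
    f g : Vector Carrier (2 ℕ.+ n)
    f j = term n (2 ℕ.* toℕ j)
    g j = term (suc n) (2 ℕ.* suc (toℕ j))

    first : term (2 ℕ.+ n) 0 ≈ c * term (suc n) 0
    first = sym (×-comm-* 1 c _)

    rest : ∀ j → term (2 ℕ.+ n) (2 ℕ.* suc j) ≈
                 p * term n (2 ℕ.* j) + c * term (suc n) (2 ℕ.* suc j)
    rest j = ≡.subst
      (λ e → term (2 ℕ.+ n) e ≈ p * term n (2 ℕ.* j) + c * term (suc n) e)
      (≡.sym (ℕ.*-suc 2 j)) (term-step n (2 ℕ.* j))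

  -- The equation is a recurrence reaching back two terms; the previous one enters only through `X`,
  -- so the induction carries agreement of `X f` and `X g` as well.
  D≋Y-unique : ∀ {f g} → D f ≋ Y f → D g ≋ Y g → f 0 ≈ g 0 → f ≋ g
  D≋Y-unique {f} {g} Df≋Yf Dg≋Yg f₀≈g₀ n = proj₁ (both n)
    where
    step : ∀ n → X f n ≈ X g n → f n ≈ g n → f (suc n) ≈ g (suc n)
    step n Xf≈Xg f≈g = trans (Df≋Yf n) (trans (+-cong Xf≈Xg (*-congˡ f≈g)) (sym (Dg≋Yg n)))

    both : ∀ n → f n ≈ g n × X f n ≈ X g n
    both zero    = f₀≈g₀ , refl
    both (suc n) =
      let f≈g , Xf≈Xg = both n in step n Xf≈Xg f≈g , *-congˡ f≈g

  -- The exponents 0, 1, ..., n add up to the binomial coefficient, and the factor 0! = 1 is dropped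
  -- from the product.
  product-powers : ∀ q n →
    product {suc n} (λ i → q ^ toℕ i * ((toℕ i !) · 1#)) ≈
    q ^ (suc n C 2) * product {n} (λ i → (suc (toℕ i) !) · 1#)
  product-powers q zero    = solve 0
    (con 1 :* (con 1 :+ con 0) :* con 1 := con 1 :* con 1) refl
  product-powers q (suc n) = begin
    product {2 ℕ.+ n} (λ i → q ^ toℕ i * ((toℕ i !) · 1#))
      ≈⟨ sum-toℕ-last *-monoid (λ i → q ^ i * ((i !) · 1#)) (suc n) ⟩
    product {suc n} (λ i → q ^ toℕ i * ((toℕ i !) · 1#)) * (q ^ suc n * ((suc n !) · 1#))
      ≈⟨ *-congʳ (product-powers q n) ⟩
    q ^ (suc n C 2) * P n * (q ^ suc n * ((suc n !) · 1#))
      ≈⟨ solve 4 (λ a b c d → (a :* b) :* (c :* d) := (c :* a) :* (b :* d))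
           refl (q ^ (suc n C 2)) (P n) (q ^ suc n) ((suc n !) · 1#) ⟩
    q ^ suc n * q ^ (suc n C 2) * (P n * ((suc n !) · 1#))
      ≈⟨ *-cong (trans (sym (^-homo-* q (suc n) (suc n C 2))) (reflexive (≡.cong (q ^_) pascal)))
                (sym (sum-toℕ-last *-monoid (λ i → (suc i !) · 1#) n)) ⟩
    q ^ (suc (suc n) C 2) * P (suc n) ∎
    where
    P : ℕ → Carrier
    P n = product {n} (λ i → (suc (toℕ i) !) · 1#)

    pascal : suc n ℕ.+ (suc n C 2) ≡ suc (suc n) C 2
    pascal = ≡.trans (≡.cong (ℕ._+ (suc n C 2)) (≡.sym (nC1≡n (suc n))))
                     (nCk+nC[k+1]≡[n+1]C[k+1] (suc n) 1)

-- The exponential of cx + x²/2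

module GaussianExponential {k ℓ₁ ℓ₂} (K : HeytingField k ℓ₁ ℓ₂) (char0 : CharacteristicZero K)
  (c : HeytingField.Carrier K) where

  open FieldOps K using (ring; _·_)
  open Series K char0 using (recip; _⊛_; _^⊛_; one; exp; cx+x²/2; egfCoeff)
  open CommutativeRing ring hiding (zero; ring)
  open LaplaceExpansion ring ℕ using (_⊕_; _⊙_)
  open Operators ring c using (Seq; _≋_; D; X; Y)
  open HermiteSum ring c using (·≈·1*)
  open SemiringMult semiring using (×1-homo-*)
  open SemiringSum semiring using (sum; sum-cong-≋; ∑-distrib-+; *-distribˡ-sum; sum-replicate-zero)
  open NatCoeffSolver commutativeSemiring
  open SetoidReasoning setoid

  recip-inverseˡ : ∀ n .{{_ : NonZero n}} → recip n * (n · 1#) ≈ 1#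
  recip-inverseˡ n = trans
    (*-congˡ (sym (trans (+-congˡ (RingProperties.-0#≈0# (CommutativeRing.ring ring))) (+-identityʳ _))))
    (proj₁ (proj₂ (HeytingField.#⇒invertible K (char0 n))))

  recip! : ℕ → Carrier
  recip! n = recip (n !) {{n !≢0}}

  recip!-suc : ∀ n → recip! (suc n) * (suc n · 1#) ≈ recip! n
  recip!-suc n = begin
    r′ * m                      ≈⟨ *-identityʳ _ ⟨
    r′ * m * 1#                 ≈⟨ *-congˡ (recip-inverseˡ (n !) {{n !≢0}}) ⟨
    r′ * m * (r * f)            ≈⟨ solve 4 (λ r′ m r f → r′ :* m :* (r :* f) := r′ :* (m :* f) :* r)
                                     refl r′ m r f ⟩
    r′ * (m * f) * r            ≈⟨ *-congʳ (*-congˡ (×1-homo-* (suc n) (n !))) ⟨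
    r′ * ((suc n !) · 1#) * r   ≈⟨ *-congʳ (recip-inverseˡ (suc n !) {{suc n !≢0}}) ⟩
    1# * r                      ≈⟨ *-identityˡ r ⟩
    r                           ∎
    where
    r′ = recip! (suc n)
    r  = recip! n
    m  = suc n · 1#
    f  = (n !) · 1#

  -- On ordinary generating functions S is multiplication by x, θ is x d/dx,
  -- and G, T are multiplication by g = cx + x²/2 and by x g′ = cx + x².
  S θ G T : Seq → Seq
  S h zero    = 0#
  S h (suc n) = h n
  θ h n       = (n · 1#) * h n
  G h         = c ⊙ S h ⊕ recip 2 ⊙ S (S h)
  T h         = c ⊙ S h ⊕ S (S h)

  g : Seq
  g = cx+x²/2 c

  -- Only degrees 1 and 2 of g are nonzero; degrees 0 and 1 of the product are separate because
  -- their convolutions are too short to contain both.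
  ⊛≋G : ∀ h → g ⊛ h ≋ G h
  ⊛≋G h zero          = solve 3 (λ c r x → con 0 :* x :+ con 0 := c :* con 0 :+ r :* con 0)
                          refl c (recip 2) (h 0)
  ⊛≋G h (suc zero)    = solve 4 (λ c r x y →
                          con 0 :* y :+ (c :* x :+ con 0) := c :* x :+ r :* con 0)
                          refl c (recip 2) (h 0) (h 1)
  ⊛≋G h (suc (suc n)) = begin
    0# * h (2 ℕ.+ n) + (c * h (suc n) + (recip 2 * h n + sum (λ (i : Fin n) → 0# * h (n ∸ suc (toℕ i)))))
      ≈⟨ +-congˡ (+-congˡ (+-congˡ (trans (sum-cong-≋ {n} (λ i → zeroˡ (h (n ∸ suc (toℕ i)))))
                                          (sum-replicate-zero n)))) ⟩
    0# * h (2 ℕ.+ n) + (c * h (suc n) + (recip 2 * h n + 0#))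
      ≈⟨ solve 3 (λ x y z → con 0 :* x :+ (y :+ (z :+ con 0)) := y :+ z)
           refl (h (2 ℕ.+ n)) (c * h (suc n)) (recip 2 * h n) ⟩
    c * h (suc n) + recip 2 * h n ∎

  S-cong : ∀ {f h} → f ≋ h → S f ≋ S h
  S-cong f≋h zero    = refl
  S-cong f≋h (suc n) = f≋h n

  S-⊕ : ∀ f h → S (f ⊕ h) ≋ S f ⊕ S h
  S-⊕ f h zero    = sym (+-identityˡ 0#)
  S-⊕ f h (suc n) = refl

  S-⊙ : ∀ p f → S (p ⊙ f) ≋ p ⊙ S f
  S-⊙ p f zero    = sym (zeroʳ p)
  S-⊙ p f (suc n) = refl

  G-cong : ∀ {f h} → f ≋ h → G f ≋ G h
  G-cong f≋h n = +-cong (*-congˡ (S-cong f≋h n)) (*-congˡ (S-cong (S-cong f≋h) n))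

  T-cong : ∀ {f h} → f ≋ h → T f ≋ T h
  T-cong f≋h n = +-cong (*-congˡ (S-cong f≋h n)) (S-cong (S-cong f≋h) n)

  G-⊙ : ∀ p f → G (p ⊙ f) ≋ p ⊙ G f
  G-⊙ p f n = trans
    (+-cong (*-congˡ (S-⊙ p f n)) (*-congˡ (trans (S-cong (S-⊙ p f) n) (S-⊙ p (S f) n))))
    (solve 5 (λ c r p x y → c :* (p :* x) :+ r :* (p :* y) := p :* (c :* x :+ r :* y))
      refl c (recip 2) p (S f n) (S (S f) n))

  S-combination : ∀ p q f h → S (p ⊙ f ⊕ q ⊙ h) ≋ p ⊙ S f ⊕ q ⊙ S h
  S-combination p q f h n = trans (S-⊕ (p ⊙ f) (q ⊙ h) n) (+-cong (S-⊙ p f n) (S-⊙ q h n))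

  S-G : ∀ f → S (G f) ≋ G (S f)
  S-G f = S-combination c (recip 2) (S f) (S (S f))

  T-G : ∀ f → T (G f) ≋ G (T f)
  T-G f n = begin
    c * S (G f) n + S (S (G f)) n
      ≈⟨ +-cong (*-congˡ (S-G f n)) (trans (S-cong (S-G f) n) (S-G (S f) n)) ⟩
    c * (c * a + r * b) + (c * b + r * d)
      ≈⟨ solve 5 (λ c r a b d →
           c :* (c :* a :+ r :* b) :+ (c :* b :+ r :* d) :=
           c :* (c :* a :+ b) :+ r :* (c :* b :+ d)) refl c r a b d ⟩
    c * (c * a + b) + r * (c * b + d)
      ≈⟨ +-cong (*-congˡ (S-T f n)) (*-congˡ (trans (S-cong (S-T f) n) (S-T (S f) n))) ⟨
    G (T f) n ∎
    where
    r = recip 2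
    a = S (S f) n
    b = S (S (S f)) n
    d = S (S (S (S f))) n
    S-T : ∀ f → S (T f) ≋ T (S f)
    S-T f n = trans (S-⊕ (c ⊙ S f) (S (S f)) n) (+-congʳ (S-⊙ c (S f) n))

  θ-cong : ∀ {f h} → f ≋ h → θ f ≋ θ h
  θ-cong f≋h n = *-congˡ (f≋h n)

  θ-S : ∀ h → θ (S h) ≋ S (θ h) ⊕ S h
  θ-S h zero    = trans (zeroʳ _) (sym (+-identityˡ 0#))
  θ-S h (suc n) = solve 2 (λ m x → (con 1 :+ m) :* x := m :* x :+ x) refl (n · 1#) (h n)

  -- The product rule for x d/dx. Moving past `S` twice doubles the x² term, which cancels
  -- `recip 2`.
  θ-G : ∀ h → θ (G h) ≋ G (θ h) ⊕ T h
  θ-G h n = begin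
    m * (c * S h n + r * S (S h) n)
      ≈⟨ solve 5 (λ m c r x y → m :* (c :* x :+ r :* y) := c :* (m :* x) :+ r :* (m :* y))
           refl m c r (S h n) (S (S h) n) ⟩
    c * θ (S h) n + r * θ (S (S h)) n
      ≈⟨ +-cong (*-congˡ (θ-S h n)) (*-congˡ (trans (θ-S (S h) n)
           (+-congʳ (trans (S-cong (θ-S h) n) (S-⊕ (S (θ h)) (S h) n))))) ⟩
    c * (S (θ h) n + S h n) + r * ((S (S (θ h)) n + S (S h) n) + S (S h) n)
      ≈⟨ solve 6 (λ c r x y z w →
           c :* (x :+ y) :+ r :* ((z :+ w) :+ w) :=
           (c :* x :+ r :* z) :+ (c :* y :+ (r :* (con 1 :+ (con 1 :+ con 0))) :* w))
           refl c r (S (θ h) n) (S h n) (S (S (θ h)) n) (S (S h) n) ⟩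
    G (θ h) n + (c * S h n + (r * (2 · 1#)) * S (S h) n)
      ≈⟨ +-congˡ (+-congˡ (trans (*-congʳ (recip-inverseˡ 2)) (*-identityˡ _))) ⟩
    G (θ h) n + T h n ∎
    where
    m = n · 1#
    r = recip 2

  powers : ℕ → Seq
  powers k = g ^⊛ k

  θ-powers : ∀ k → θ (powers (suc k)) ≋ (suc k · 1#) ⊙ T (powers k)
  θ-powers k n = begin
    θ (powers (suc k)) n
      ≈⟨ θ-cong (⊛≋G (powers k)) n ⟩
    θ (G (powers k)) n
      ≈⟨ θ-G (powers k) n ⟩
    G (θ (powers k)) n + T (powers k) n
      ≈⟨ +-congʳ (G-θ k) ⟩
    (k · 1#) * T (powers k) n + T (powers k) n
      ≈⟨ solve 2 (λ m x → m :* x :+ x := (con 1 :+ m) :* x) refl (k · 1#) (T (powers k) n) ⟩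
    (suc k · 1#) * T (powers k) n ∎
    where
    -- Zero is written as a multiple of `one` so that `G-⊙` can extract the factor.
    θ-one : θ one ≋ 0# ⊙ one
    θ-one zero    = refl
    θ-one (suc n) = trans (zeroʳ _) (sym (zeroˡ _))

    -- This is g · x(gᵏ)′ = k x g′ gᵏ, the power rule one step lower multiplied by g, so the two
    -- recursions alternate.
    G-θ : ∀ k → G (θ (powers k)) n ≈ (k · 1#) * T (powers k) n
    G-θ zero    = trans (G-cong θ-one n) (trans (G-⊙ 0# one n) (trans (zeroˡ _) (sym (zeroˡ _))))
    G-θ (suc k) = begin
      G (θ (powers (suc k))) n                  ≈⟨ G-cong (θ-powers k) n ⟩
      G ((suc k · 1#) ⊙ T (powers k)) n         ≈⟨ G-⊙ (suc k · 1#) (T (powers k)) n ⟩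
      (suc k · 1#) * G (T (powers k)) n         ≈⟨ *-congˡ (T-G (powers k) n) ⟨
      (suc k · 1#) * T (G (powers k)) n         ≈⟨ *-congˡ (T-cong (⊛≋G (powers k)) n) ⟨
      (suc k · 1#) * T (powers (suc k)) n       ∎

  -- Since g has no constant term, each factor raises the order; this justifies cutting off the
  -- exponential sum at k ≤ n.
  powers-below : ∀ {n k} → n < k → powers k n ≈ 0#
  powers-below {n} {suc k} (s≤s n≤k) = trans (⊛≋G (powers k) n)
    (trans (+-cong (trans (*-congˡ (S-below n≤k)) (zeroʳ c))
                   (trans (*-congˡ (SS-below n≤k)) (zeroʳ _)))
           (+-identityˡ 0#))
    where
    S-below : ∀ {n} → n ≤ k → S (powers k) n ≈ 0#
    S-below {zero}  _   = refl
    S-below {suc n} n<k = powers-below n<k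

    SS-below : ∀ {n} → n ≤ k → S (S (powers k)) n ≈ 0#
    SS-below {zero}        _   = refl
    SS-below {suc zero}    _   = refl
    SS-below {suc (suc n)} n<k = powers-below (ℕ.<⇒≤ n<k)

  -- n [xⁿ] f = [xⁿ] x g′ f for f = exp g.
  exp-recurrence : ∀ n → (suc n · 1#) * exp g (suc n) ≈ c * exp g n + S (exp g) n
  exp-recurrence n = begin
    -- The summand k = 0 is constant and drops out; in the others the factor k + 1 from the power
    -- rule turns 1/(k + 1)! into 1/k!.
    m * (recip! 0 * 0# + sum t)
      ≈⟨ *-congˡ (trans (+-congʳ (zeroʳ _)) (+-identityˡ _)) ⟩
    m * sum t
      ≈⟨ *-distribˡ-sum m t ⟩
    sum (λ j → m * t j)
      ≈⟨ sum-cong-≋ {suc n} (summand ∘ toℕ) ⟩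
    sum {suc n} (λ j → c * e n (toℕ j) + Se n (toℕ j))
      ≈⟨ ∑-distrib-+ {suc n} (λ j → c * e n (toℕ j)) (Se n ∘ toℕ) ⟩
    sum {suc n} (λ j → c * e n (toℕ j)) + sum {suc n} (Se n ∘ toℕ)
      ≈⟨ +-cong (sym (*-distribˡ-sum {suc n} c (e n ∘ toℕ))) (shifted n) ⟩
    c * exp g n + S (exp g) n ∎
    where
    m = suc n · 1#

    t : Vector Carrier (suc n)
    t j = recip! (suc (toℕ j)) * powers (suc (toℕ j)) (suc n)

    e Se : ℕ → ℕ → Carrier
    e n k  = recip! k * powers k n
    Se n k = recip! k * S (powers k) n

    summand : ∀ k → m * (recip! (suc k) * powers (suc k) (suc n)) ≈ c * e n k + Se n k
    summand k = begin
      m * (recip! (suc k) * powers (suc k) (suc n))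
        ≈⟨ solve 3 (λ m r x → m :* (r :* x) := r :* (m :* x))
             refl m (recip! (suc k)) (powers (suc k) (suc n)) ⟩
      recip! (suc k) * θ (powers (suc k)) (suc n)
        ≈⟨ *-congˡ (θ-powers k (suc n)) ⟩
      recip! (suc k) * ((suc k · 1#) * (c * powers k n + S (powers k) n))
        ≈⟨ trans (sym (*-assoc _ _ _)) (*-congʳ (recip!-suc k)) ⟩
      recip! k * (c * powers k n + S (powers k) n)
        ≈⟨ solve 4 (λ r c x y → r :* (c :* x :+ y) := c :* (r :* x) :+ r :* y)
             refl (recip! k) c (powers k n) (S (powers k) n) ⟩
      c * e n k + Se n k ∎

    -- The left side has one summand more than the exponential in degree n - 1; that one is gⁿ in
    -- degree n - 1, which is zero.
    shifted : ∀ n → sum {suc n} (Se n ∘ toℕ) ≈ S (exp g) n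
    shifted zero    = trans (+-identityʳ _) (zeroʳ _)
    shifted (suc n) = trans
      (sum-toℕ-last +-monoid (e n) (suc n))
      (trans (+-congˡ (trans (*-congˡ (powers-below {n} ℕ.≤-refl)) (zeroʳ _))) (+-identityʳ _))

  a : Seq
  a = egfCoeff (exp g)

  a₀≈1 : a 0 ≈ 1#
  a₀≈1 = trans (solve 1 (λ r → r :* con 1 :+ con 0 :+ con 0 := r :* (con 1 :+ con 0)) refl (recip! 0))
    (recip-inverseˡ 1)

  D-a : D a ≋ Y a
  D-a n = begin
    (suc n !) · F (suc n)
      ≈⟨ ·≈·1* (suc n !) _ ⟩
    ((suc n !) · 1#) * F (suc n)
      ≈⟨ *-congʳ (×1-homo-* (suc n) (n !)) ⟩
    ((suc n · 1#) * f) * F (suc n)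
      ≈⟨ solve 3 (λ m f x → m :* f :* x := f :* (m :* x)) refl (suc n · 1#) f (F (suc n)) ⟩
    f * ((suc n · 1#) * F (suc n))
      ≈⟨ *-congˡ (exp-recurrence n) ⟩
    f * (c * F n + S F n)
      ≈⟨ solve 4 (λ f c x y → f :* (c :* x :+ y) := f :* y :+ c :* (f :* x)) refl f c (F n) (S F n) ⟩
    f * S F n + c * (f * F n)
      ≈⟨ +-cong (X-a n) (*-congˡ (sym (·≈·1* (n !) (F n)))) ⟩
    X a n + c * a n ∎
    where
    F = exp g
    f = (n !) · 1#

    X-a : ∀ n → ((n !) · 1#) * S F n ≈ X a n
    X-a zero    = zeroʳ _
    X-a (suc n) = begin
      ((suc n !) · 1#) * F n               ≈⟨ *-congʳ (×1-homo-* (suc n) (n !)) ⟩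
      (suc n · 1#) * ((n !) · 1#) * F n    ≈⟨ *-assoc _ _ _ ⟩
      (suc n · 1#) * (((n !) · 1#) * F n)  ≈⟨ *-congˡ (·≈·1* (n !) (F n)) ⟨
      (suc n · 1#) * a n                   ∎

theorem5p1 : ∀ {k ℓ₁ ℓ₂} (K : HeytingField k ℓ₁ ℓ₂) (char0 : CharacteristicZero K) →
    let open Series K char0 in
    (c : Carrier) →
    let f = exp (cx+x²/2 c) in
    (∀ n → egfCoeff f n ≈
    sum (λ (j : Fin (suc n)) →
    ((n C (2 ℕ.* toℕ j)) ℕ.* (2 ℕ.* toℕ j ∸ 1) !!) · (c ^ (n ∸ 2 ℕ.* toℕ j))))
    ×
    (∀ n → n ≥ 1 →
    dilatedHankel n f ≈
    (2 · c) ^ (n C 2) * product {n ∸ 1} (λ i → (suc (toℕ i) !) · 1#))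
theorem5p1 K char0 c =
  -- The coefficients and the explicit sum satisfy the same equation with initial value 1.
  D≋Y-unique D-a D-hermite (trans a₀≈1 hermite₀≈1) , hankel
  where
  open FieldOps K using (_·_; product; _^_)
  open CommutativeRing (FieldOps.ring K) hiding (zero)
  open Series K char0 using (dilatedHankel; exp; cx+x²/2)
  open TriangularDeterminant (FieldOps.ring K) using (det-LU)
  open Operators (FieldOps.ring K) c using (ladder; ladder-below; ladder-diagonal; module Ladder)
  open HermiteSum (FieldOps.ring K) c
  open GaussianExponential K char0 c
  open SetoidReasoning setoid

  hermite₀≈1 : 1# ≈ hermite 0
  hermite₀≈1 = sym (trans (+-identityʳ _) (+-identityʳ _))

  2·c≈c+c : 2 · c ≈ c + c
  2·c≈c+c = +-congˡ (+-identityʳ c)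

  hankel : ∀ n → n ≥ 1 → dilatedHankel n (exp (cx+x²/2 c)) ≈
    (2 · c) ^ (n C 2) * product {n ∸ 1} (λ i → (suc (toℕ i) !) · 1#)
  hankel (suc n) _ = begin
    dilatedHankel (suc n) (exp (cx+x²/2 c))
      ≈⟨ det-LU (λ i j → a (2 ℕ.* i ℕ.+ j)) (ladder a)
           (Ladder.even-derivative-monic D-a) (ladder-below a) (suc n) ⟩
    product {suc n} (λ i → ladder a (toℕ i) (toℕ i))
      ≈⟨ MonoidSum.sum-cong-≋ *-monoid {suc n} (λ i → ladder-diagonal a a₀≈1 (toℕ i)) ⟩
    product {suc n} (λ i → (c + c) ^ toℕ i * ((toℕ i !) · 1#))
      ≈⟨ product-powers (c + c) n ⟩
    (c + c) ^ (suc n C 2) * product {n} (λ i → (suc (toℕ i) !) · 1#)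
      ≈⟨ *-congʳ (SemiringExp.^-congˡ semiring (suc n C 2) 2·c≈c+c) ⟨
    (2 · c) ^ (suc n C 2) * product {n} (λ i → (suc (toℕ i) !) · 1#) ∎
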